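{- Let $F[\pi^*]$ be a reducible permutation flow-graph of size $O(n^*)$ produced by the algorithm Encode_SiP.to.RPG from a self-inverting permutation $\pi^*$ of length $n^*$. The algorithm Decode_RPG.to.SiP decodes the flow-graph $F[\pi^*]$ (that is, extracts the permutation $\pi^*$ from it) in $O(n^*)$ time and space.
   Context: A permutation $\pi=(\pi_1,\ldots,\pi_{m})$ over $\{1,\ldots,m\}$ is self-inverting if $\pi_{\pi_i}=i$ for all $i$; its length is $m$. Let $\pi^{ -1}_i$ denote the position of $i$ in the sequence $\pi$. Domination: an element $i$ of $\pi$ dominates $j$ if $i>j$ and $\pi^{ -1}_i<\pi^{ -1}_j$; $i$ directly dominates (d-dominates) $j$ if $i$ dominates $j$ and there is no $k$ in $\pi$ such that $i$ dominates $k$ and $k$ dominates $j$. $dmax(j)$ is the maximum of the elements of $\pi$ that d-dominate $j$; if no element of $\pi$ dominates $j$, then $dmax(j)=m+1$ (the dummy element $s=m+1$ is regarded as placed before all elements of $\pi$ and dominating all of them). Algorithm Encode_SiP.to.RPG (input: self-inverting permutation $\pi^*$ of length $n^*$; output: $F[\pi^*]$): 1. For each element $i\in\pi^*$, $1\le i\le n^*$, compute $P(i)=dmax(i)$. 2. Construct a directed graph $F[\pi^*]$ with vertex set $\{s=u_{n^*+1},u_{n^*},\ldots,u_1,u_0=t\}$ and the forward edges $(u_{i+1},u_i)$, $0\le i\le n^*$. 3. For each $1\le i\le n^*$ add the backward edge $(u_i,u_m)$ where $m=P(i)$. 4. Return $F[\pi^*]$. The graph $F[\pi^*]$ has $n^*+2$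 nodes and $2n^*+1$ edges; node $u_i$ carries the label $i$. Algorithm Decode_RPG.to.SiP (input: $F[\pi^*]$; output: a permutation of length $n^*$): 1. Delete the forward edges $(u_i,u_{i-1})$, $1\le i\le n^*+1$, and the node $t=u_0$. 2. Flip (reverse) all the remaining edges, i.e. the backward edges, yielding a directed tree $T_d[\pi^*]$ (the Dmax-tree) with nodes $s,u_1,\ldots,u_{n^*}$, rooted at $s$. 3. Perform a depth-first search on $T_d[\pi^*]$ starting at $s$, always proceeding to the minimum-labeled (unvisited) child node, and compute the DFS discovery time of each node. 4. Order the nodes $u_1,\ldots,u_{n^*}$ by increasing DFS discovery time and let $\pi$ be the resulting sequence (of node labels). 5. Return $\pi$. Time and space are counted in the usual unit-cost RAM sense. -}

module Defs where

open import Data.Bool.Base using (Bool; true; false; if_then_else_)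
open import Data.Fin.Base using (Fin; zero; suc; toℕ) renaming (_<_ to _<ᶠ_)
import Data.Fin.Properties as Fin
open import Data.Fin.Permutation using (Permutation′; _⟨$⟩ʳ_; _⟨$⟩ˡ_)
open import Data.List.Base
  using (List; []; _∷_; _++_; _∷ʳ_; length; map; filter; upTo; downFrom; allFin; tabulate; applyUpTo)
open import Data.List.Extrema.Nat using (max; min)
open import Data.List.Relation.Binary.Permutation.Propositional using (_↭_)
import Data.List.Sort as Sort
open import Data.Nat.Base using (ℕ; zero; suc; _+_; _*_; _∸_; _≤_; _<_; _≡ᵇ_; _<ᵇ_)
import Data.Nat.Properties as ℕ
open import Data.List.Membership.DecPropositional ℕ._≟_ using (_∉?_)
open import Data.Product.Base using (∃-syntax; _×_; _,_; proj₁; proj₂; swap)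
open import Data.Unit.Base using (⊤)
import Relation.Binary.Construct.On as On
open import Relation.Binary.PropositionalEquality using (_≡_)
open import Relation.Nullary.Decidable using (Dec; does; ¬?; _×-dec_)
open import Relation.Nullary.Negation using (¬_)

-- The element i ∈ {1,…,n} is represented by the index i - 1 : Fin n, and
-- positions likewise; π ⟨$⟩ʳ p is the element at position p and
-- π ⟨$⟩ˡ i the position of the element i.

label : ∀ {n} → Fin n → ℕ
label i = suc (toℕ i)

sequence : ∀ {n} → Permutation′ n → List ℕ
sequence π = tabulate (λ p → label (π ⟨$⟩ʳ p))

SelfInverting : ∀ {n} → Permutation′ n → Set
SelfInverting π = ∀ i → π ⟨$⟩ʳ (π ⟨$⟩ʳ i) ≡ i

module _ {n : ℕ} (π : Permutation′ n) where

  Dominates : Fin n → Fin n → Set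
  Dominates i j = j <ᶠ i × π ⟨$⟩ˡ i <ᶠ π ⟨$⟩ˡ j

  DDominates : Fin n → Fin n → Set
  DDominates i j = Dominates i j × ¬ (∃[ k ] Dominates i k × Dominates k j)

  dominates? : ∀ i j → Dec (Dominates i j)
  dominates? i j = (j Fin.<? i) ×-dec (π ⟨$⟩ˡ i Fin.<? π ⟨$⟩ˡ j)

  dDominates? : ∀ i j → Dec (DDominates i j)
  dDominates? i j =
    dominates? i j ×-dec ¬? (Fin.any? (λ k → dominates? i k ×-dec dominates? k j))

  dmax : Fin n → ℕ
  dmax j =
    if does (Fin.any? (λ i → dominates? i j))
    then max 0 (map label (filter (λ i → dDominates? i j) (allFin n)))
    else suc n

-- The node uᵢ is identified with its label i; (a , b) is an edge from a to b.
record Graph : Set where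
  constructor graph
  field
    nodes : List ℕ
    edges : List (ℕ × ℕ)

open Graph public

-- The same nodes and edges, listed in a possibly different order.
infix 4 _≅_
_≅_ : Graph → Graph → Set
G ≅ H = nodes G ↭ nodes H × edges G ↭ edges H

encode : ∀ {n} → Permutation′ n → Graph
encode {n} π = graph (downFrom (2 + n)) (forward ++ backward)
  where
  forward  = map (λ i → suc i , i) (upTo (suc n))
  backward = map (λ i → label i , dmax π i) (allFin n)

-- Backward edges lead to larger labels, so the forward edges are exactly those
-- of the form (i , i - 1).  Only the forward edge (1 , 0) is incident to t.
deleteForward : Graph → Graph
deleteForward G = graph
  (filter (λ v → ¬? (v ℕ.≟ 0)) (nodes G))
  (filter (λ e → ¬? (proj₁ e ℕ.≟ suc (proj₂ e))) (edges G))

flip : Graph → Graph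
flip G = graph (nodes G) (map swap (edges G))

dmaxTree : Graph → Graph
dmaxTree F = flip (deleteForward F)

children : Graph → ℕ → List ℕ
children T v = map proj₂ (filter (λ e → proj₁ e ℕ.≟ v) (edges T))

-- The search keeps the path from the root to the current node
-- (current node first) and the nodes discovered so far, in order of
-- discovery.  One move either discovers the minimum unvisited child of the
-- current node or backtracks.
SearchState : Set
SearchState = List ℕ × List ℕ

advance : ℕ → List ℕ → List ℕ → (unvisited : List ℕ) → SearchState
advance v path seen []       = path , seen
advance v path seen (w ∷ ws) = min w ws ∷ v ∷ path , seen ∷ʳ min w ws

move : Graph → SearchState → SearchState
move T ([]       , seen) = [] , seen
move T (v ∷ path , seen) = advance v path seen (filter (_∉? seen) (children T v))

moves : ℕ → Graph → SearchState → SearchState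
moves zero    T st = st
moves (suc k) T st = moves k T (move T st)

-- Every node is entered once and left once, so twice the number of nodes
-- is enough moves to finish the search.
dfs : Graph → ℕ → List ℕ
dfs T s = proj₂ (moves (2 * length (nodes T)) T (s ∷ [] , s ∷ []))

-- The discovery time of a node is its index in the order of discovery.
discoveryTime : List ℕ → ℕ → ℕ
discoveryTime []       v = 0
discoveryTime (u ∷ us) v = if u ≡ᵇ v then 0 else suc (discoveryTime us v)

sortBy : (ℕ → ℕ) → List ℕ → List ℕ
sortBy time = Sort.sort (On.decTotalOrder ℕ.≤-decTotalOrder time)

-- The nodes of the tree are labelled 1,…,n+1 and s carries the largest
-- label, which is therefore the number of nodes of the tree.
decode : Graph → List ℕ
decode F = sortBy (discoveryTime (dfs T s)) (filter (λ v → ¬? (v ℕ.≟ s)) (nodes T))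
  where
  T = dmaxTree F
  s = length (nodes T)

-- A unit-cost RAM with R registers and A arrays of natural numbers.  The
-- arrays are equivalent, up to a constant factor, to one memory in
-- which they are interleaved.  The only arithmetic is addition and
-- truncated subtraction.

module RAM (R A : ℕ) where

  infixl 6 _⊕_ _⊖_
  infix  5 _≐_ _≺_
  infix  4 _:=_ _[_]:=_
  infixr 3 _⨟_

  data Expr : Set where
    lit  : ℕ → Expr
    reg  : Fin R → Expr
    arr  : Fin A → Expr → Expr
    _⊕_  : Expr → Expr → Expr
    _⊖_  : Expr → Expr → Expr

  data Test : Set where
    _≐_ : Expr → Expr → Test
    _≺_ : Expr → Expr → Test

  data Cmd : Set where
    skip   : Cmd
    _:=_   : Fin R → Expr → Cmd
    _[_]:=_ : Fin A → Expr → Expr → Cmd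
    _⨟_    : Cmd → Cmd → Cmd
    ifelse : Test → Cmd → Cmd → Cmd
    while  : Test → Cmd → Cmd

  record State : Set where
    constructor state
    field
      regs   : Fin R → ℕ
      arrays : Fin A → ℕ → ℕ

  open State public

  setReg : Fin R → ℕ → State → State
  regs   (setReg x v σ) y = if does (y Fin.≟ x) then v else regs σ y
  arrays (setReg x v σ)   = arrays σ

  setArr : Fin A → ℕ → ℕ → State → State
  regs   (setArr a i v σ)     = regs σ
  arrays (setArr a i v σ) b j =
    if does (b Fin.≟ a) then (if j ≡ᵇ i then v else arrays σ b j) else arrays σ b j

  eval : State → Expr → ℕ
  eval σ (lit k)   = k
  eval σ (reg x)   = regs σ x
  eval σ (arr a e) = arrays σ a (eval σ e)
  eval σ (d ⊕ e)   = eval σ d + eval σ e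
  eval σ (d ⊖ e)   = eval σ d ∸ eval σ e

  test : State → Test → Bool
  test σ (d ≐ e) = eval σ d ≡ᵇ eval σ e
  test σ (d ≺ e) = eval σ d <ᵇ eval σ e

  cost : Expr → ℕ
  cost (lit k)   = 1
  cost (reg x)   = 1
  cost (arr a e) = 1 + cost e
  cost (d ⊕ e)   = 1 + (cost d + cost e)
  cost (d ⊖ e)   = 1 + (cost d + cost e)

  costᵗ : Test → ℕ
  costᵗ (d ≐ e) = 1 + (cost d + cost e)
  costᵗ (d ≺ e) = 1 + (cost d + cost e)

  -- Every array access made in evaluating the expression is to one of the
  -- first m cells of the array.
  InBounds : ℕ → State → Expr → Set
  InBounds m σ (lit k)   = ⊤
  InBounds m σ (reg x)   = ⊤
  InBounds m σ (arr a e) = InBounds m σ e × eval σ e < m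
  InBounds m σ (d ⊕ e)   = InBounds m σ d × InBounds m σ e
  InBounds m σ (d ⊖ e)   = InBounds m σ d × InBounds m σ e

  InBoundsᵗ : ℕ → State → Test → Set
  InBoundsᵗ m σ (d ≐ e) = InBounds m σ d × InBounds m σ e
  InBoundsᵗ m σ (d ≺ e) = InBounds m σ d × InBounds m σ e

  -- m ⊢ c , σ ⇓[ t ] τ : on arrays of m cells each, the command c started in
  -- state σ halts in state τ after time t.
  infix 3 _⊢_,_⇓[_]_
  data _⊢_,_⇓[_]_ (m : ℕ) : Cmd → State → ℕ → State → Set where

    skip : ∀ {σ} → m ⊢ skip , σ ⇓[ 1 ] σ

    assign : ∀ {σ x e} → InBounds m σ e →
      m ⊢ x := e , σ ⇓[ 1 + cost e ] setReg x (eval σ e) σ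

    store : ∀ {σ a d e} → InBounds m σ d → InBounds m σ e → eval σ d < m →
      m ⊢ a [ d ]:= e , σ ⇓[ 1 + (cost d + cost e) ] setArr a (eval σ d) (eval σ e) σ

    seq : ∀ {σ τ υ c d t u} →
      m ⊢ c , σ ⇓[ t ] τ → m ⊢ d , τ ⇓[ u ] υ → m ⊢ c ⨟ d , σ ⇓[ t + u ] υ

    ifelse-true : ∀ {σ τ b c d t} → InBoundsᵗ m σ b → test σ b ≡ true →
      m ⊢ c , σ ⇓[ t ] τ → m ⊢ ifelse b c d , σ ⇓[ costᵗ b + t ] τ

    ifelse-false : ∀ {σ τ b c d t} → InBoundsᵗ m σ b → test σ b ≡ false →
      m ⊢ d , σ ⇓[ t ] τ → m ⊢ ifelse b c d , σ ⇓[ costᵗ b + t ] τ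

    while-true : ∀ {σ τ υ b c t u} → InBoundsᵗ m σ b → test σ b ≡ true →
      m ⊢ c , σ ⇓[ t ] τ → m ⊢ while b c , τ ⇓[ u ] υ →
      m ⊢ while b c , σ ⇓[ costᵗ b + (t + u) ] υ

    while-false : ∀ {σ b c} → InBoundsᵗ m σ b → test σ b ≡ false →
      m ⊢ while b c , σ ⇓[ costᵗ b ] σ

  -- The space used is the number of registers plus the number of array cells,
  -- those holding the input and the output included.
  HaltsWithin : (time space : ℕ) → Cmd → State → State → Set
  HaltsWithin time space c σ τ =
    ∃[ t ] ∃[ m ] t ≤ time × R + A * m ≤ space × m ⊢ c , σ ⇓[ t ] τ

open RAM 9 7 public

pattern #N       = zero
pattern #E       = suc zero
pattern rootᵣ    = suc (suc zero)
pattern kᵣ       = suc (suc (suc zero))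
pattern lastᵣ    = suc (suc (suc (suc zero)))
pattern vᵣ       = suc (suc (suc (suc (suc zero))))
pattern wᵣ       = suc (suc (suc (suc (suc (suc zero)))))
pattern timeᵣ    = suc (suc (suc (suc (suc (suc (suc zero))))))
pattern activeᵣ  = suc (suc (suc (suc (suc (suc (suc (suc zero)))))))

pattern srcₐ     = zero
pattern tgtₐ     = suc zero
pattern parentₐ  = suc (suc zero)
pattern headₐ    = suc (suc (suc zero))
pattern nextₐ    = suc (suc (suc (suc zero)))
pattern discₐ    = suc (suc (suc (suc (suc zero))))
pattern outₐ     = suc (suc (suc (suc (suc (suc zero)))))

-- A remaining edge (a , b), flipped to (b , a), makes b the
-- parent of a.
buildTree : Cmd
buildTree =
  kᵣ := lit 0 ⨟
  while (reg kᵣ ≺ reg #E)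
    ( ifelse (arr srcₐ (reg kᵣ) ≐ arr tgtₐ (reg kᵣ) ⊕ lit 1)
        skip
        (parentₐ [ arr srcₐ (reg kᵣ) ]:= arr tgtₐ (reg kᵣ))
    ⨟ kᵣ := reg kᵣ ⊕ lit 1 )

-- Linked lists of children: head v is the first child of v and next w the
-- sibling following w.  As t = 0 has been deleted, 0 marks the end of a list.
-- Prepending the nodes n,…,1 in this order makes every list increasing.
listChildren : Cmd
listChildren =
  kᵣ := reg lastᵣ ⨟
  while (lit 0 ≺ reg kᵣ)
    ( nextₐ [ reg kᵣ ]:= arr headₐ (arr parentₐ (reg kᵣ))
    ⨟ headₐ [ arr parentₐ (reg kᵣ) ]:= reg kᵣ
    ⨟ kᵣ := reg kᵣ ⊖ lit 1 )

-- head v is advanced past every child that is visited, so it is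
-- always the minimum unvisited child of v.  The path to the root is
-- recovered from the parent pointers.
search : Cmd
search =
  vᵣ := reg rootᵣ ⨟
  timeᵣ := lit 0 ⨟
  discₐ [ reg rootᵣ ]:= lit 0 ⨟
  activeᵣ := lit 1 ⨟
  while (lit 0 ≺ reg activeᵣ)
    (ifelse (lit 0 ≺ arr headₐ (reg vᵣ))
      ( wᵣ := arr headₐ (reg vᵣ)
      ⨟ headₐ [ reg vᵣ ]:= arr nextₐ (reg wᵣ)
      ⨟ timeᵣ := reg timeᵣ ⊕ lit 1
      ⨟ discₐ [ reg wᵣ ]:= reg timeᵣ
      ⨟ vᵣ := reg wᵣ )
      (ifelse (reg vᵣ ≐ reg rootᵣ)
        (activeᵣ := lit 0)
        (vᵣ := arr parentₐ (reg vᵣ))))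

-- The discovery times of u₁,…,uₙ are 1,…,n, so sorting by them is
-- writing every node into the cell given by its time.
orderByTime : Cmd
orderByTime =
  kᵣ := reg lastᵣ ⨟
  while (lit 0 ≺ reg kᵣ)
    ( outₐ [ arr discₐ (reg kᵣ) ]:= reg kᵣ
    ⨟ kᵣ := reg kᵣ ⊖ lit 1 )

decodeProgram : Cmd
decodeProgram =
  rootᵣ := reg #N ⊖ lit 1 ⨟
  lastᵣ := reg #N ⊖ lit 2 ⨟
  buildTree ⨟
  listChildren ⨟
  search ⨟
  orderByTime

cell : List ℕ → ℕ → ℕ
cell []       i       = 0
cell (x ∷ xs) zero    = x
cell (x ∷ xs) (suc i) = cell xs i

-- The input: the number of nodes, the number of edges, and the sources and
-- targets of the edges.  All other registers and cells are 0.
input : Graph → State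
regs (input G) #N = length (nodes G)
regs (input G) #E = length (edges G)
regs (input G) _  = 0
arrays (input G) srcₐ = cell (map proj₁ (edges G))
arrays (input G) tgtₐ = cell (map proj₂ (edges G))
arrays (input G) _    = λ _ → 0

-- The output is in cells 1,…,n.
output : ℕ → State → List ℕ
output n σ = applyUpTo (λ i → arrays σ outₐ (suc i)) n

infix 4 _∈O_
_∈O_ : (ℕ → ℕ) → (ℕ → ℕ) → Set
f ∈O g = ∃[ c ] ∃[ n₀ ] (∀ n → n₀ ≤ n → f n ≤ c * g n)

{-# OPTIONS --safe #-}
module Submission where

-- dmax(j) is the nearest element to the left of j that is greater than j, the
-- dummy s being placed at position 0.  Hence the elements strictly between
-- dmax(j) and j are smaller than j, which makes siblings in the Dmax-tree occur
-- in π in increasing order, and dmax of an element lies on the tree path from s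
-- to the element just before it.  So a search that always enters the minimum
-- unvisited child discovers the elements in the order of π.  The search
-- makes 2n + 1 moves; the RAM program performs each in constant time, because the
-- lists of children, increasing in label, are also increasing in discovery time.

open import Defs
open import Data.Bool.Base using (true; false; if_then_else_)
open import Data.Fin.Base using (Fin; zero; suc; toℕ; fromℕ<)
open import Data.Fin.Permutation using (Permutation′; _⟨$⟩ʳ_; _⟨$⟩ˡ_; inverseˡ; inverseʳ)
import Data.Fin.Properties as Fin
open import Data.List.Base
  using (List; []; _∷_; _∷ʳ_; allFin; applyUpTo; downFrom; filter; length; map; tabulate; upTo)
open import Data.List.Extrema.Nat using (max≈v⁺; min≤v⁺; v≤min⁺)
open import Data.List.Membership.Propositional using (_∈_; _∉_; lose)
open import Data.List.Membership.Propositional.Properties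
open import Data.List.Membership.Propositional.Properties.WithK using (unique∧set⇒bag)
open import Data.List.Properties
  using (applyUpTo-∷ʳ; filter-all; filter-reject; length-++; length-applyUpTo; length-downFrom;
         length-map; length-tabulate; length-upTo)
open import Data.List.Relation.Binary.BagAndSetEquality using (∼bag⇒↭)
open import Data.List.Relation.Binary.Permutation.Propositional
  using (_↭_; ↭-sym; ↭-trans; ↭-reflexive; ↭⇒↭ₛ′)
open import Data.List.Relation.Binary.Permutation.Propositional.Properties
  using (∈-resp-↭; ↭-length; filter-↭)
open import Data.List.Relation.Binary.Pointwise.Base using (Pointwise; []; _∷_)
import Data.List.Relation.Unary.All as All
open import Data.List.Relation.Unary.Any using (here; there)
open import Data.List.Relation.Unary.Linked using (Linked)
import Data.List.Relation.Unary.Linked.Properties as Linked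
open import Data.List.Relation.Unary.Sorted.TotalOrder.Properties using (↗↭↗⇒≋)
import Data.List.Relation.Unary.Unique.Propositional.Properties as Unique
import Data.List.Sort as Sort
open import Data.Nat.Base
  using (ℕ; zero; suc; _+_; _*_; _∸_; _≤_; _<_; z≤n; s≤s; z<s; s<s; s≤s⁻¹; _≡ᵇ_; _<ᵇ_)
open import Data.Nat.Properties
open import Data.List.Membership.DecPropositional _≟_ using (_∉?_)
open import Data.Nat.Tactic.RingSolver using (solve-∀)
open import Data.Product.Base using (∃-syntax; _×_; _,_; proj₁; proj₂; swap)
open import Data.Sum.Base using (_⊎_; inj₁; inj₂)
open import Data.Unit.Base using (tt)
open import Function.Base using (_∘_; _∋_; case_of_; id)
open import Function.Bundles using (mk⇔)
open import Relation.Binary.Bundles using (DecTotalOrder)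
import Relation.Binary.Construct.On as On
open import Relation.Binary.Definitions using (tri<; tri≈; tri>)
open import Relation.Binary.PropositionalEquality
open import Relation.Nullary using (¬_; yes; no; contradiction)
open import Relation.Nullary.Decidable using (dec-true; dec-false; ¬?)

-- The course of the search is settled once, in `Walk`, from π alone: n discoveries and n + 1
-- retreats. The search on the graph and the search loop of the program are each shown to follow
-- this schedule. It turns "unvisited" into an inequality: when positions up to p have been
-- discovered, the unvisited nodes are those at positions greater than p. In the time bound, the
-- four loops of the program run 2n + 1, n, 2n + 1 and n times, at a cost of 19, 16, 23 and 11 per
-- round, tests included. This gives the coefficient 111; the rest adds up to 77.

cell-tabulate : ∀ {n} (f : Fin n → ℕ) i → cell (tabulate f) (toℕ i) ≡ f i
cell-tabulate f zero    = refl
cell-tabulate f (suc i) = cell-tabulate (f ∘ suc) i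

cell-tabulate-beyond : ∀ {n} (f : Fin n → ℕ) → cell (tabulate f) n ≡ 0
cell-tabulate-beyond {zero}  f = refl
cell-tabulate-beyond {suc n} f = cell-tabulate-beyond (f ∘ suc)

module _ {n : ℕ} (π : Permutation′ n) where

  dmax-undominated : ∀ {i} → (∀ k → ¬ Dominates π k i) → dmax π i ≡ suc n
  dmax-undominated {i} ¬dom
    rewrite dec-false (Fin.any? (λ k → dominates? π k i)) (λ (k , dom) → ¬dom k dom) = refl

  dmax-greatest : ∀ {i k} → DDominates π k i →
    (∀ l → DDominates π l i → toℕ l ≤ toℕ k) → dmax π i ≡ label k
  dmax-greatest {i} {k} dd@(dom , _) greatest
    rewrite dec-true (Fin.any? (λ l → dominates? π l i)) (k , dom) =
    max≈v⁺ {xs = map label (filter (λ l → dDominates? π l i) (allFin n))}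
      (∈-map∘filter⁺ label (λ l → dDominates? π l i) (k , ∈-allFin k , refl , dd))
      (All.tabulate λ x∈ →
        let (l , _ , x≡ , ddₗ) = ∈-map∘filter⁻ label (λ l → dDominates? π l i) {xs = allFin n} x∈
        in subst (_≤ label k) (sym x≡) (s≤s (greatest l ddₗ)))
      z≤n

-- The Dmax-tree and its depth-first search

module Tree {n : ℕ} (π : Permutation′ n) where

  -- Position 0 holds the dummy s = n + 1; pos (n + 1) is 0 because cell returns 0
  -- beyond the end of the list.
  lab pos parent : ℕ → ℕ
  lab    = cell (suc n ∷ sequence π)
  pos    = cell (0 ∷ tabulate (λ i → label (π ⟨$⟩ˡ i)))
  parent = cell (0 ∷ tabulate (dmax π))

  -- Matching on it exposes the `Fin` index behind a number between 1 and n, so that later arguments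
  -- stay in the natural numbers, where the dummy at position 0 fits too. It serves for labels and
  -- positions alike.
  data Node : ℕ → Set where
    node : (i : Fin n) → Node (label i)

  node⁺ : ∀ {c} → 0 < c → c ≤ n → Node c
  node⁺ {suc c} _ c<n = subst (Node ∘ suc) (Fin.toℕ-fromℕ< c<n) (node (fromℕ< c<n))

  node>0 : ∀ {c} → Node c → 0 < c
  node>0 (node i) = z<s

  node≤n : ∀ {c} → Node c → c ≤ n
  node≤n (node i) = Fin.toℕ<n i

  lab-label : ∀ i → lab (label i) ≡ label (π ⟨$⟩ʳ i)
  lab-label = cell-tabulate (λ i → label (π ⟨$⟩ʳ i))

  pos-label : ∀ i → pos (label i) ≡ label (π ⟨$⟩ˡ i)
  pos-label = cell-tabulate (λ i → label (π ⟨$⟩ˡ i))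

  parent-label : ∀ i → parent (label i) ≡ dmax π i
  parent-label = cell-tabulate (dmax π)

  lab-node : ∀ {p} → Node p → Node (lab p)
  lab-node (node i) = subst Node (sym (lab-label i)) (node _)

  pos-node : ∀ {c} → Node c → Node (pos c)
  pos-node (node i) = subst Node (sym (pos-label i)) (node _)

  pos-root : pos (suc n) ≡ 0
  pos-root = cell-tabulate-beyond (λ i → label (π ⟨$⟩ˡ i))

  lab-pos : ∀ {c} → Node c → lab (pos c) ≡ c
  lab-pos (node i) = trans (cong lab (pos-label i)) (trans (lab-label (π ⟨$⟩ˡ i)) (cong label (inverseʳ π)))

  pos-lab : ∀ {p} → p ≤ n → pos (lab p) ≡ p
  pos-lab {zero}  _ = pos-root
  pos-lab {suc p} p≤n with node i ← node⁺ z<s p≤n =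
    trans (cong pos (lab-label i)) (trans (pos-label (π ⟨$⟩ʳ i)) (cong label (inverseˡ π)))

  lab-injective : ∀ {p q} → p ≤ n → q ≤ n → lab p ≡ lab q → p ≡ q
  lab-injective p≤n q≤n eq = trans (sym (pos-lab p≤n)) (trans (cong pos eq) (pos-lab q≤n))

  -- Parents as nearest greater elements to the left

  NearestGreater : ℕ → ℕ → ℕ → Set
  NearestGreater c m r = r < m × c < lab r × (∀ i → r < i → i < m → lab i < c)

  -- A scan to the left from position m, which is kept apart from q for the induction. It stops at
  -- position 0 at the latest, where the dummy exceeds every label.
  nearestGreater : ∀ {q} → Node q → ∀ m → m < q → ∃[ r ] NearestGreater (lab q) (suc m) r
  nearestGreater {q} q∈ zero _ =
    0 , z<s , s≤s (node≤n (lab-node q∈)) , λ i 0<i i<1 → contradiction 0<i (<⇒≱ i<1)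
  nearestGreater {q} q∈ (suc m) m<q with lab q <? lab (suc m)
  ... | yes q<m = suc m , n<1+n _ , q<m , λ i m<i i≤m → contradiction m<i (≤⇒≯ (s≤s⁻¹ i≤m))
  ... | no  q≮m with (r , r<m , q<r , between) ← nearestGreater q∈ m (<⇒≤ m<q) =
    r , m<n⇒m<1+n r<m , q<r , λ i r<i i≤m → case m≤n⇒m<n∨m≡n (s≤s⁻¹ i≤m) of λ where
      (inj₁ i<m)  → between i r<i i<m
      (inj₂ refl) → ≤∧≢⇒< (≮⇒≥ q≮m) λ eq →
        <⇒≢ m<q (lab-injective (≤-trans (<⇒≤ m<q) (node≤n q∈)) (node≤n q∈) eq)

  -- All between r and q is smaller than `lab q`, so the element at r dominates it directly, and
  -- every other dominator stands left of r. One that is greater than `lab r` dominates `lab q`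
  -- through `lab r`, hence not directly. So `lab r` is the greatest direct dominator. For r = 0
  -- nothing dominates and `dmax` takes its default n + 1.
  parent-nearestGreater : ∀ {q} → Node q → ∀ {r} → NearestGreater (lab q) q r → parent (lab q) ≡ lab r
  parent-nearestGreater {q} (node j) {r} (r<q , q<r , between) = begin
    parent (lab q)     ≡⟨ cong parent (lab-label j) ⟩
    parent (label c)   ≡⟨ parent-label c ⟩
    dmax π c           ≡⟨ dmax≡ r r<q q<r between ⟩
    lab r              ∎
    where
    open ≡-Reasoning
    c = π ⟨$⟩ʳ j

    lab-label⁻¹ : ∀ k → lab (label (π ⟨$⟩ˡ k)) ≡ label k
    lab-label⁻¹ k = trans (lab-label (π ⟨$⟩ˡ k)) (cong label (inverseʳ π))

    before : ∀ {k} → Dominates π k c → label (π ⟨$⟩ˡ k) < q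
    before {k} (_ , k⊏c) = s≤s (subst (λ p → toℕ (π ⟨$⟩ˡ k) < toℕ p) (inverseˡ π) k⊏c)

    greater : ∀ {k} → Dominates π k c → lab q < lab (label (π ⟨$⟩ˡ k))
    greater {k} (c<k , _) = subst₂ _<_ (sym (lab-label j)) (sym (lab-label⁻¹ k)) (s≤s c<k)

    dmax≡ : ∀ r → r < q → lab q < lab r → (∀ i → r < i → i < q → lab i < lab q) → dmax π c ≡ lab r
    dmax≡ zero _ _ between = dmax-undominated π λ k dom →
      <-asym (greater dom) (between _ z<s (before dom))
    dmax≡ (suc r) r<q q<r between with node⁺ z<s (<⇒≤ (<-≤-trans r<q (Fin.toℕ<n j)))
    ... | node p = trans (dmax-greatest π (dom , nothing-between) greatest) (sym (lab-label p))
      where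
      k = π ⟨$⟩ʳ p

      dom : Dominates π k c
      dom = s≤s⁻¹ (subst₂ _<_ (lab-label j) (lab-label p) q<r) ,
            subst₂ (λ x y → toℕ x < toℕ y) (sym (inverseˡ π)) (sym (inverseˡ π)) (s≤s⁻¹ r<q)

      after : ∀ {l} → label p < label (π ⟨$⟩ˡ l) → ¬ Dominates π l c
      after p<l domₗ = <-asym (greater domₗ) (between _ p<l (before domₗ))

      nothing-between : ¬ (∃[ l ] Dominates π k l × Dominates π l c)
      nothing-between (l , (_ , k⊏l) , domₗ) =
        after (s≤s (subst (λ x → toℕ x < toℕ (π ⟨$⟩ˡ l)) (inverseˡ π) k⊏l)) domₗ

      greatest : ∀ l → DDominates π l c → toℕ l ≤ toℕ k
      greatest l (domₗ , ¬between) with <-cmp (toℕ (π ⟨$⟩ˡ l)) (toℕ p)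
      ... | tri> _ _ p<l = contradiction domₗ (after (s≤s p<l))
      ... | tri≈ _ l≡p _ = ≤-reflexive (cong toℕ
              (trans (sym (inverseʳ π)) (cong (π ⟨$⟩ʳ_) (Fin.toℕ-injective l≡p))))
      ... | tri< l<p _ _ = ≮⇒≥ λ k<l → ¬between (k , (k<l ,
              subst (λ x → toℕ (π ⟨$⟩ˡ l) < toℕ x) (sym (inverseˡ π)) l<p) , dom)

  parent-unique : ∀ {c} → Node c → ∀ {r} → NearestGreater c (pos c) r → parent c ≡ lab r
  parent-unique {c} c∈ {r} nearest = trans (cong parent (sym (lab-pos c∈)))
    (parent-nearestGreater (pos-node c∈) (subst (λ x → NearestGreater x (pos c) r) (sym (lab-pos c∈)) nearest))

  parent-spec : ∀ {c} → Node c → NearestGreater c (pos c) (pos (parent c))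
  parent-spec {c} c∈ with pos c in eq | pos-node c∈
  -- Positions of elements start at 1, so there is a position q just before c from which to scan.
  ... | suc q | q∈ with (r , nearest@(r<q , _)) ← nearestGreater q∈ q (n<1+n q) =
    subst₂ (λ x → NearestGreater x (suc q))
      (trans (cong lab (sym eq)) (lab-pos c∈))
      (sym (trans (cong pos parent≡) (pos-lab (≤-trans (<⇒≤ r<q) (node≤n q∈)))))
      nearest
    where
    parent≡ : parent c ≡ lab r
    parent≡ = trans (cong parent (trans (sym (lab-pos c∈)) (cong lab eq))) (parent-nearestGreater q∈ nearest)

  parent-inner : ∀ {c} → Node c → parent c ≡ suc n ⊎ Node (parent c)
  parent-inner {c} c∈ with parent-spec c∈
  ... | r<q , _ with pos (parent c) | parent-unique c∈ (parent-spec c∈)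
  ... | zero  | eq = inj₁ eq
  ... | suc r | eq = inj₂ (subst Node (sym eq) (lab-node (node⁺ z<s (≤-trans (<⇒≤ r<q) (node≤n (pos-node c∈))))))

  lab-pos-parent : ∀ {c} → Node c → lab (pos (parent c)) ≡ parent c
  lab-pos-parent c∈ = sym (parent-unique c∈ (parent-spec c∈))

  parent-greater : ∀ {c} → Node c → c < parent c
  parent-greater c∈ with (_ , c<r , _) ← parent-spec c∈ = subst (_ <_) (lab-pos-parent c∈) c<r

  siblings : ∀ {c d} → Node c → Node d → parent c ≡ parent d → pos c < pos d → c < d
  siblings c∈ d∈ eq c⊏d with (r<c , _) ← parent-spec c∈ | (_ , _ , between) ← parent-spec d∈ =
    subst (_< _) (lab-pos c∈) (between _ (subst (λ x → pos x < _) eq r<c) c⊏d)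

  -- The program orders children by label, while being visited is a matter of position; the search
  -- loop needs the passage in both directions.
  siblings⁻¹ : ∀ {c d} → Node c → Node d → parent c ≡ parent d → c < d → pos c < pos d
  siblings⁻¹ {c} {d} c∈ d∈ eq c<d with <-cmp (pos c) (pos d)
  ... | tri< c⊏d _ _ = c⊏d
  ... | tri≈ _ eq′ _ = contradiction (trans (sym (lab-pos c∈)) (trans (cong lab eq′) (lab-pos d∈))) (<⇒≢ c<d)
  ... | tri> _ _ d⊏c = contradiction (siblings d∈ c∈ (sym eq) d⊏c) (<-asym c<d)

  data Chain : List ℕ → Set where
    empty : Chain []
    root  : Chain (suc n ∷ [])
    child : ∀ {c v vs} → Node c → parent c ≡ v → Chain (v ∷ vs) → Chain (c ∷ v ∷ vs)

  chain-tail : ∀ {v vs} → Chain (v ∷ vs) → Chain vs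
  chain-tail root              = empty
  chain-tail (child _ _ chain) = chain

  chain-pos : ∀ {v vs} → Chain (v ∷ vs) → lab (pos v) ≡ v
  chain-pos root           = cong lab pos-root
  chain-pos (child c∈ _ _) = lab-pos c∈

  chain-before : ∀ {v vs u} → Chain (v ∷ vs) → u ∈ vs → pos u < pos v
  chain-before (child c∈ refl chain) u∈ with (r<q , _) ← parent-spec c∈ with u∈
  ... | here refl = r<q
  ... | there u∈′ = <-trans (chain-before chain u∈′) r<q

  -- Climb from u. If c < u, then u is the nearest greater element left of c. Otherwise u < c, and
  -- the elements between the parent of u and u, being smaller than u, are smaller than c too, so
  -- `between` carries over to the parent. The root exceeds every label, which ends the climb.
  parent-on-chain : ∀ {c u us} → Node c → Chain (u ∷ us) → pos u < pos c →
    (∀ i → pos u < i → i < pos c → lab i < c) → parent c ∈ u ∷ us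
  parent-on-chain {c} {u} c∈ chain u⊏c between with c <? u
  ... | yes c<u = here (trans
          (parent-unique c∈ (u⊏c , subst (c <_) (sym (chain-pos chain)) c<u , between)) (chain-pos chain))
  parent-on-chain c∈ root _ _ | no c≮u = contradiction (s≤s (node≤n c∈)) c≮u
  parent-on-chain {c} {u} c∈ (child {v = v} u∈ refl chain) u⊏c between | no c≮u with (v⊏u , _ , between′) ← parent-spec u∈ =
    there (parent-on-chain c∈ chain (<-trans v⊏u u⊏c) between″)
    where
    u<c : u < c
    u<c = ≤∧≢⇒< (≮⇒≥ c≮u) λ where refl → <-irrefl refl u⊏c

    between″ : ∀ i → pos v < i → i < pos c → lab i < c
    between″ i v⊏i i⊏c with <-cmp i (pos u)
    ... | tri< i⊏u _ _  = <-trans (between′ i v⊏i i⊏u) u<c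
    ... | tri≈ _ refl _ = subst (_< c) (sym (lab-pos u∈)) u<c
    ... | tri> _ _ u⊏i  = between i u⊏i i⊏c

  -- Walk ℓ p path: once positions 0,…,p have been discovered and path is the
  -- current path, the search ends after ℓ more moves.
  data Walk : ℕ → ℕ → List ℕ → Set where
    done     : Walk 0 n []
    discover : ∀ {ℓ p v vs} → p < n → parent (lab (suc p)) ≡ v →
               Walk ℓ (suc p) (lab (suc p) ∷ v ∷ vs) → Walk (suc ℓ) p (v ∷ vs)
    back     : ∀ {ℓ p v vs} → (∀ {c} → Node c → parent c ≡ v → pos c ≤ p) →
               Walk ℓ p vs → Walk (suc ℓ) p (v ∷ vs)

  -- Every node on the path has yet to be left, and each of the j undiscovered ones to be entered
  -- and left. The outer recursion is on j; `go` pops nodes until the parent of the next element is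
  -- on top, and `pending` ensures that it is on the path.
  walk : ∀ j {p} vs → p + j ≡ n → Chain vs → (∀ {v} → v ∈ vs → pos v ≤ p) →
    (p < n → parent (lab (suc p)) ∈ vs) → Walk (length vs + (j + j)) p vs
  walk zero {p} [] p≡n chain visited pending = subst (λ x → Walk 0 x []) (trans (sym p≡n) (+-identityʳ p)) done
  walk zero {p} (v ∷ vs) p≡n chain visited pending = back
    (λ c∈ _ → subst (_ ≤_) (sym p≡n′) (node≤n (pos-node c∈)))
    (walk zero vs p≡n (chain-tail chain) (visited ∘ there) λ p<n → contradiction p≡n′ (<⇒≢ p<n))
    where
    p≡n′ : p ≡ n
    p≡n′ = trans (sym (+-identityʳ p)) p≡n
  walk (suc j) {p} vs p+j≡n chain visited pending = go vs chain visited (pending p<n)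
    where
    p<n : p < n
    p<n = subst (p <_) p+j≡n (m<m+n p z<s)

    w∈ : Node (lab (suc p))
    w∈ = lab-node (node⁺ z<s p<n)

    go : ∀ vs → Chain vs → (∀ {v} → v ∈ vs → pos v ≤ p) →
         parent (lab (suc p)) ∈ vs → Walk (length vs + (suc j + suc j)) p vs
    go (v ∷ vs) chain visited parent∈ with parent (lab (suc p)) ≟ v
    ... | yes eq = discover p<n eq (subst (λ ℓ → Walk ℓ (suc p) (lab (suc p) ∷ v ∷ vs)) measure
            (walk j (lab (suc p) ∷ v ∷ vs) (trans (sym (+-suc p j)) p+j≡n) (child w∈ eq chain) visited′ pending′))
      where
      measure : suc (suc (length vs + (j + j))) ≡ length vs + (suc j + suc j)
      measure = sym (trans (+-suc (length vs) (j + suc j))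
        (cong suc (trans (cong (length vs +_) (+-suc j j)) (+-suc (length vs) (j + j)))))

      visited′ : ∀ {u} → u ∈ lab (suc p) ∷ v ∷ vs → pos u ≤ suc p
      visited′ (here refl) = ≤-reflexive (pos-lab p<n)
      visited′ (there u∈)  = m≤n⇒m≤1+n (visited u∈)

      pending′ : suc p < n → parent (lab (suc (suc p))) ∈ lab (suc p) ∷ v ∷ vs
      pending′ 1+p<n = parent-on-chain (lab-node (node⁺ z<s 1+p<n)) (child w∈ eq chain)
        (subst₂ _<_ (sym (pos-lab p<n)) (sym (pos-lab 1+p<n)) (n<1+n _))
        -- The node just discovered immediately precedes the next element, so no position lies
        -- strictly between.
        λ i p<i i<q → contradiction
          (≤-<-trans (subst (λ x → suc x ≤ i) (pos-lab p<n) p<i) (subst (i <_) (pos-lab 1+p<n) i<q))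
          (<-irrefl refl)
    ... | no parent≢v with parent∈
    ...   | here eq = contradiction eq parent≢v
    ...   | there parent∈′ = back exhausted (go vs (chain-tail chain) (visited ∘ there) parent∈′)
      where
      -- If a child c of v stood beyond position p + 1, the element w at p + 1 would lie between v
      -- and c, so w < c < v. But the parent of w is a proper ancestor of v and stands before it, so
      -- v lies between that parent and w, whence v < w.
      exhausted : ∀ {c} → Node c → parent c ≡ v → pos c ≤ p
      exhausted {c} c∈ refl with <-cmp (suc p) (pos c)
      ... | tri> _ _ c≤p = s≤s⁻¹ c≤p
      ... | tri≈ _ eq _  = contradiction (cong parent (trans (cong lab eq) (lab-pos c∈))) parent≢v
      ... | tri< p+1<c _ _ with (_ , c<v , between) ← parent-spec c∈ | (_ , _ , between′) ← parent-spec w∈ =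
        contradiction
          (between′ _ (chain-before chain parent∈′)
            (subst (pos v <_) (sym (pos-lab p<n)) (s≤s (visited (here refl)))))
          (<-asym (<-trans (between _ (s≤s (visited (here refl))) p+1<c) c<v))

  initialWalk : Walk (1 + (n + n)) 0 (suc n ∷ [])
  initialWalk = walk n (suc n ∷ []) refl root visited pending
    where
    visited : ∀ {v} → v ∈ suc n ∷ [] → pos v ≤ 0
    visited (here refl) = ≤-reflexive pos-root

    pending : 0 < n → parent (lab 1) ∈ suc n ∷ []
    pending 0<n with w∈ ← lab-node (node⁺ {1} z<s 0<n)
      with parent (lab 1) | lab-pos-parent w∈ | parent-spec w∈
    -- The parent of the first element stands before position 1, so it is the root.
    ... | v | eq | r<1 , _ rewrite n<1⇒n≡0 (subst (pos v <_) (pos-lab 0<n) r<1) = here (sym eq)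

advance-none : ∀ {v path seen us} → (∀ {u} → u ∉ us) → advance v path seen us ≡ (path , seen)
advance-none {us = []}    _  = refl
advance-none {us = _ ∷ _} u∉ = contradiction (here refl) u∉

advance-least : ∀ {v path seen m us} → m ∈ us → (∀ {u} → u ∈ us → m ≤ u) →
  advance v path seen us ≡ (m ∷ v ∷ path , seen ∷ʳ m)
advance-least {v} {path} {seen} {m} {u ∷ us} m∈ least = cong (λ x → x ∷ v ∷ path , seen ∷ʳ x)
  (≤-antisym (min≤v⁺ u us below) (v≤min⁺ (least (here refl)) (All.tabulate (least ∘ there))))
  where
  below : _
  below = case m∈ of λ where
    (here refl) → inj₁ ≤-refl
    (there m∈′) → inj₂ (lose m∈′ ≤-refl)

-- `dfs` allows 2n + 2 moves, one more than the search makes.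
moves-empty : ∀ k T {seen} → moves k T ([] , seen) ≡ ([] , seen)
moves-empty zero    T = refl
moves-empty (suc k) T = moves-empty k T

discoveryTime-applyUpTo : ∀ f n → (∀ {p q} → p < n → q < n → f p ≡ f q → p ≡ q) →
  ∀ {p} → p < n → discoveryTime (applyUpTo f n) (f p) ≡ p
discoveryTime-applyUpTo f (suc n) inj {zero} _
  -- `does (m ≟ n)` computes to `m ≡ᵇ n`, so `dec-true` and `dec-false` settle boolean tests, those
  -- of the program included.
  rewrite dec-true (f 0 ≟ f 0) refl = refl
discoveryTime-applyUpTo f (suc n) inj {suc p} p<n
  rewrite dec-false (f 0 ≟ f (suc p)) (λ eq → case inj z<s p<n eq of λ ()) =
  cong suc (discoveryTime-applyUpTo (f ∘ suc) n
    (λ p<n q<n → suc-injective ∘ inj (s<s p<n) (s<s q<n)) (s≤s⁻¹ p<n))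

applyUpTo-cell-tabulate : ∀ {n} (f : Fin n → ℕ) → applyUpTo (cell (tabulate f)) n ≡ tabulate f
applyUpTo-cell-tabulate {zero}  f = refl
applyUpTo-cell-tabulate {suc n} f = cong (f zero ∷_) (applyUpTo-cell-tabulate (f ∘ suc))

-- Two sorted permutations of a list agree pointwise only in the equality of the order, that is, in
-- time; injectivity of `time` turns this into equality.
sortBy-unique : ∀ time {xs ys} → xs ↭ ys → Linked (λ x y → time x ≤ time y) ys →
  (∀ {x y} → x ∈ ys → y ∈ ys → time x ≡ time y → x ≡ y) → sortBy time xs ≡ ys
sortBy-unique time {xs} {ys} xs↭ys ys↗ inj =
  pointwise-≡ (↗↭↗⇒≋ (DecTotalOrder.totalOrder O) (Sort.sort-↗ O xs) ys↗ (↭⇒↭ₛ′ (DecTotalOrder.Eq.isEquivalence O) zs↭ys))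
    (∈-resp-↭ zs↭ys) (λ y∈ → y∈)
  where
  O = On.decTotalOrder ≤-decTotalOrder time

  zs↭ys : sortBy time xs ↭ ys
  zs↭ys = ↭-trans (Sort.sort-↭ O xs) xs↭ys

  pointwise-≡ : ∀ {zs ws} → Pointwise (λ x y → time x ≡ time y) zs ws →
    (∀ {x} → x ∈ zs → x ∈ ys) → (∀ {x} → x ∈ ws → x ∈ ys) → zs ≡ ws
  pointwise-≡ []         _  _  = refl
  pointwise-≡ (eq ∷ eqs) zs⊆ ws⊆ =
    cong₂ _∷_ (inj (zs⊆ (here refl)) (ws⊆ (here refl)) eq) (pointwise-≡ eqs (zs⊆ ∘ there) (ws⊆ ∘ there))

-- Decoding the flow-graph

module FlowGraph {n : ℕ} (π : Permutation′ n) (F : Graph) (F≅ : F ≅ encode π) where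

  open Tree π

  T : Graph
  T = dmaxTree F

  forward backward : List (ℕ × ℕ)
  forward  = map (λ i → suc i , i) (upTo (suc n))
  backward = map (λ i → label i , dmax π i) (allFin n)

  -- The order of the edges of `F` is arbitrary, so everything about them is drawn from membership,
  -- here and in `edge⁺`, and from their number.
  edge⁻ : ∀ {a b} → (a , b) ∈ edges F → (a ≡ suc b × b ≤ n) ⊎ (Node a × b ≡ parent a)
  edge⁻ e∈ with ∈-++⁻ forward (∈-resp-↭ (proj₂ F≅) e∈)
  ... | inj₁ f∈ with i , i∈ , refl ← ∈-map⁻ _ f∈ = inj₁ (refl , s≤s⁻¹ (∈-upTo⁻ i∈))
  ... | inj₂ b∈ with i , _ , refl ← ∈-map⁻ _ b∈ = inj₂ (node i , sym (parent-label i))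

  edge⁺ : ∀ {c} → Node c → (c , parent c) ∈ edges F
  edge⁺ (node i) = ∈-resp-↭ (↭-sym (proj₂ F≅)) (∈-++⁺ʳ forward
    (subst (λ x → (label i , x) ∈ backward) (sym (parent-label i)) (∈-map⁺ _ (∈-allFin i))))

  backward≢forward : ∀ {c} → Node c → c ≢ suc (parent c)
  backward≢forward c∈ = <⇒≢ (m<n⇒m<1+n (parent-greater c∈))

  child⁺ : ∀ {c v} → Node c → parent c ≡ v → c ∈ children T v
  child⁺ {c} c∈ refl = ∈-map⁺ proj₂ (∈-filter⁺ (λ e → proj₁ e ≟ parent c)
    (∈-map⁺ swap (∈-filter⁺ (λ e → ¬? (proj₁ e ≟ suc (proj₂ e))) (edge⁺ c∈) (backward≢forward c∈))) refl)

  child⁻ : ∀ {c v} → c ∈ children T v → Node c × parent c ≡ v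
  child⁻ {c} {v} c∈
    with _ , e∈ , refl ← ∈-map⁻ proj₂ c∈
    with e∈′ , refl ← ∈-filter⁻ (λ e → proj₁ e ≟ v) {xs = edges T} e∈
    with _ , e∈″ , refl ← ∈-map⁻ swap e∈′
    with e∈F , ≢forward ← ∈-filter⁻ (λ e → ¬? (proj₁ e ≟ suc (proj₂ e))) {xs = edges F} e∈″
    with edge⁻ e∈F
  ... | inj₁ (eq , _)     = contradiction eq ≢forward
  ... | inj₂ (c∈T , refl) = c∈T , refl

  seen : ℕ → List ℕ
  seen p = applyUpTo lab (suc p)

  seen⁺ : ∀ {p c} → Node c → pos c ≤ p → c ∈ seen p
  seen⁺ c∈ c≤p = subst (_∈ seen _) (lab-pos c∈) (∈-applyUpTo⁺ lab (s≤s c≤p))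

  seen⁻ : ∀ {p c} → p ≤ n → c ∈ seen p → pos c ≤ p
  seen⁻ p≤n c∈ with i , i≤p , refl ← ∈-applyUpTo⁻ lab c∈ =
    subst (_≤ _) (sym (pos-lab (≤-trans (s≤s⁻¹ i≤p) p≤n))) (s≤s⁻¹ i≤p)

  moves-walk : ∀ {ℓ p path} → Walk ℓ p path → p ≤ n → ∀ {k} → ℓ ≤ k →
    moves k T (path , seen p) ≡ ([] , seen n)
  moves-walk done _ {k} _ = moves-empty k T
  moves-walk {p = p} {v ∷ vs} (discover p<n parent≡ walk) p≤n {suc k} ℓ≤k = begin
    moves k T (advance v vs (seen p) unvisited)                      ≡⟨ cong (moves k T) (advance-least w∈ least) ⟩
    moves k T (lab (suc p) ∷ v ∷ vs , seen p ∷ʳ lab (suc p))         ≡⟨ cong (λ s → moves k T (lab (suc p) ∷ v ∷ vs , s)) (applyUpTo-∷ʳ lab (suc p)) ⟩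
    moves k T (lab (suc p) ∷ v ∷ vs , seen (suc p))                  ≡⟨ moves-walk walk p<n (s≤s⁻¹ ℓ≤k) ⟩
    ([] , seen n)                                                    ∎
    where
    open ≡-Reasoning
    unvisited = filter (_∉? seen p) (children T v)

    w-node : Node (lab (suc p))
    w-node = lab-node (node⁺ z<s p<n)

    w∈ : lab (suc p) ∈ unvisited
    w∈ = ∈-filter⁺ (_∉? seen p) (child⁺ w-node parent≡)
      λ w∈ → <-irrefl refl (subst (_≤ p) (pos-lab p<n) (seen⁻ p≤n w∈))

    -- An unvisited child of v stands at position p + 1 or later; if later, it is a later sibling of
    -- the next element and thus greater.
    least : ∀ {c} → c ∈ unvisited → lab (suc p) ≤ c
    least {c} c∈ with c∈T , c∉ ← ∈-filter⁻ (_∉? seen p) {xs = children T v} c∈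
      with c-node , refl ← child⁻ c∈T with m≤n⇒m<n∨m≡n (≰⇒> (c∉ ∘ seen⁺ c-node))
    ... | inj₁ w⊏c = <⇒≤ (siblings w-node c-node parent≡ (subst (_< pos c) (sym (pos-lab p<n)) w⊏c))
    ... | inj₂ w≡c = ≤-reflexive (trans (cong lab w≡c) (lab-pos c-node))
  moves-walk {p = p} {v ∷ vs} (back exhausted walk) p≤n {suc k} ℓ≤k =
    trans (cong (moves k T) (advance-none none)) (moves-walk walk p≤n (s≤s⁻¹ ℓ≤k))
    where
    none : ∀ {c} → c ∉ filter (_∉? seen p) (children T v)
    none c∈ with c∈T , c∉ ← ∈-filter⁻ (_∉? seen p) {xs = children T v} c∈
      with c-node , refl ← child⁻ c∈T = c∉ (seen⁺ c-node (exhausted c-node refl))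

  seen-n : seen n ≡ suc n ∷ sequence π
  seen-n = cong (suc n ∷_) (applyUpTo-cell-tabulate (λ p → label (π ⟨$⟩ʳ p)))

  treeNodes : nodes T ↭ seen n
  treeNodes = ↭-trans (filter-↭ nonzero? (proj₁ F≅)) (∼bag⇒↭ (unique∧set⇒bag
    (Unique.filter⁺ nonzero? (Unique.downFrom⁺ (2 + n)))
    (Unique.applyUpTo⁺₁ lab (suc n) λ i<j j≤n eq →
      <⇒≢ i<j (lab-injective (<⇒≤ (<-≤-trans i<j (s≤s⁻¹ j≤n))) (s≤s⁻¹ j≤n) eq))
    (mk⇔ to from)))
    where
    nonzero? = λ v → ¬? (v ≟ 0)

    to : ∀ {v} → v ∈ filter nonzero? (downFrom (2 + n)) → v ∈ seen n
    to v∈ with v∈′ , v≢0 ← ∈-filter⁻ nonzero? {xs = downFrom (2 + n)} v∈ with m≤n⇒m<n∨m≡n (s≤s⁻¹ (∈-downFrom⁻ v∈′))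
    ... | inj₂ refl = here refl
    ... | inj₁ v≤n with v-node ← node⁺ (n≢0⇒n>0 v≢0) (s≤s⁻¹ v≤n) = seen⁺ v-node (node≤n (pos-node v-node))

    from : ∀ {v} → v ∈ seen n → v ∈ filter nonzero? (downFrom (2 + n))
    from v∈ with ∈-applyUpTo⁻ lab v∈
    ... | zero  , _   , refl = ∈-filter⁺ nonzero? (∈-downFrom⁺ ≤-refl) λ ()
    ... | suc i , i<n , refl with v-node ← lab-node (node⁺ z<s (s≤s⁻¹ i<n)) =
      ∈-filter⁺ nonzero? (∈-downFrom⁺ (s≤s (m≤n⇒m≤1+n (node≤n v-node)))) (>⇒≢ (node>0 v-node))

  length-treeNodes : length (nodes T) ≡ suc n
  length-treeNodes = trans (↭-length treeNodes) (length-applyUpTo lab (suc n))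

  dfs-seen : dfs T (suc n) ≡ seen n
  dfs-seen = cong proj₂ (moves-walk initialWalk z≤n bound)
    where
    bound : 1 + (n + n) ≤ 2 * length (nodes T)
    bound rewrite length-treeNodes | +-identityʳ n = s≤s (+-monoʳ-≤ n (n≤1+n n))

  decode≡sequence : decode F ≡ sequence π
  decode≡sequence = decode≡ (length (nodes T)) length-treeNodes
    where
    time : ℕ → ℕ
    time = discoveryTime (seen n)

    time-lab : ∀ {p} → p ≤ n → time (lab p) ≡ p
    time-lab p≤n = discoveryTime-applyUpTo lab (suc n)
      (λ p<n q<n → lab-injective (s≤s⁻¹ p<n) (s≤s⁻¹ q<n)) (s≤s p≤n)

    sequence⊆ : ∀ {x} → x ∈ sequence π → Node x
    sequence⊆ x∈ with p , refl ← ∈-tabulate⁻ x∈ = node _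

    time-node : ∀ {c} → Node c → time c ≡ pos c
    time-node c∈ = trans (cong time (sym (lab-pos c∈))) (time-lab (node≤n (pos-node c∈)))

    rootless : filter (λ v → ¬? (v ≟ suc n)) (suc n ∷ sequence π) ≡ sequence π
    rootless = trans (filter-reject (λ v → ¬? (v ≟ suc n)) λ ≢root → ≢root refl)
      (filter-all (λ v → ¬? (v ≟ suc n)) (All.tabulate λ x∈ → <⇒≢ (s≤s (node≤n (sequence⊆ x∈)))))

    sorted : Linked (λ x y → time x ≤ time y) (sequence π)
    sorted = subst (Linked _) (applyUpTo-cell-tabulate (λ p → label (π ⟨$⟩ʳ p)))
      (Linked.applyUpTo⁺₁ (lab ∘ suc) n λ {i} 1+i<n →
        subst₂ _≤_ (sym (time-lab (<⇒≤ 1+i<n))) (sym (time-lab 1+i<n)) (n≤1+n _))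

    -- The root is a variable here so that its equation with n + 1 can be matched with `refl`.
    decode≡ : ∀ s → s ≡ suc n →
      sortBy (discoveryTime (dfs T s)) (filter (λ v → ¬? (v ≟ s)) (nodes T)) ≡ sequence π
    decode≡ _ refl rewrite dfs-seen = sortBy-unique time
      (↭-trans (filter-↭ (λ v → ¬? (v ≟ suc n)) (↭-trans treeNodes (↭-reflexive seen-n))) (↭-reflexive rootless))
      sorted
      λ x∈ y∈ eq → trans (sym (lab-pos (sequence⊆ x∈)))
        (trans (cong lab (trans (sym (time-node (sequence⊆ x∈))) (trans eq (time-node (sequence⊆ y∈)))))
          (lab-pos (sequence⊆ y∈)))

-- Execution of RAM programs

-- A total-correctness triple. Time is bounded rather than exact because the branches of a
-- conditional differ in cost.
Runs : ℕ → Cmd → State → ℕ → (State → Set) → Set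
Runs m c σ bound Post = ∃[ t ] ∃[ τ ] t ≤ bound × m ⊢ c , σ ⇓[ t ] τ × Post τ

loopBody : Cmd → Cmd
loopBody (_ ⨟ c)     = loopBody c
loopBody (while _ c) = c
loopBody c           = c

module _ {m : ℕ} where

  runs-skip : ∀ {σ Post} → Post σ → Runs m skip σ 1 Post
  runs-skip post = 1 , _ , ≤-refl , skip , post

  runs-assign : ∀ {σ x e Post} → InBounds m σ e → Post (setReg x (eval σ e) σ) →
    Runs m (x := e) σ (1 + cost e) Post
  runs-assign e∈ post = _ , _ , ≤-refl , assign e∈ , post

  runs-store : ∀ {σ a d e Post} → InBounds m σ d → InBounds m σ e → eval σ d < m →
    Post (setArr a (eval σ d) (eval σ e) σ) → Runs m (a [ d ]:= e) σ (1 + (cost d + cost e)) Post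
  runs-store d∈ e∈ d<m post = _ , _ , ≤-refl , store d∈ e∈ d<m , post

  runs-seq : ∀ {σ c d s t Mid Post} → Runs m c σ s Mid → (∀ {τ} → Mid τ → Runs m d τ t Post) →
    Runs m (c ⨟ d) σ (s + t) Post
  runs-seq (_ , _ , s≤ , c⇓ , mid) run with _ , _ , t≤ , d⇓ , post ← run mid =
    _ , _ , +-mono-≤ s≤ t≤ , seq c⇓ d⇓ , post

  -- With "the rest runs" as intermediate assertion, each branch of a conditional hands its own
  -- concrete state on.
  runs-then : ∀ {σ c d s t Post} → Runs m c σ s (λ τ → Runs m d τ t Post) → Runs m (c ⨟ d) σ (s + t) Post
  runs-then run = runs-seq run id

  assign-then : ∀ {σ x e d t Post} → InBounds m σ e → Runs m d (setReg x (eval σ e) σ) t Post →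
    Runs m (x := e ⨟ d) σ (1 + cost e + t) Post
  assign-then e∈ (_ , _ , t≤ , d⇓ , post) =
    _ , _ , +-monoʳ-≤ _ t≤ , seq (assign e∈) d⇓ , post

  store-then : ∀ {σ a d e c t Post} → InBounds m σ d → InBounds m σ e → eval σ d < m →
    Runs m c (setArr a (eval σ d) (eval σ e) σ) t Post →
    Runs m (a [ d ]:= e ⨟ c) σ (1 + (cost d + cost e) + t) Post
  store-then d∈ e∈ d<m (_ , _ , t≤ , c⇓ , post) =
    _ , _ , +-monoʳ-≤ _ t≤ , seq (store d∈ e∈ d<m) c⇓ , post

  runs-true : ∀ {σ b c d t Post} → InBoundsᵗ m σ b → test σ b ≡ true → Runs m c σ t Post →
    Runs m (ifelse b c d) σ (costᵗ b + t) Post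
  runs-true b∈ b≡ (_ , _ , t≤ , c⇓ , post) =
    _ , _ , +-monoʳ-≤ _ t≤ , ifelse-true b∈ b≡ c⇓ , post

  runs-false : ∀ {σ b c d t Post} → InBoundsᵗ m σ b → test σ b ≡ false → Runs m d σ t Post →
    Runs m (ifelse b c d) σ (costᵗ b + t) Post
  runs-false b∈ b≡ (_ , _ , t≤ , d⇓ , post) =
    _ , _ , +-monoʳ-≤ _ t≤ , ifelse-false b∈ b≡ d⇓ , post

  runs-weaken : ∀ {σ c s t Post} → s ≤ t → Runs m c σ s Post → Runs m c σ t Post
  runs-weaken s≤t (_ , _ , ≤s , c⇓ , post) = _ , _ , ≤-trans ≤s s≤t , c⇓ , post

  -- The index of `Inv` is the number of rounds left, so `Inv` is invariant and variant at once. The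
  -- final `costᵗ b` pays for the failing test.
  runs-while : ∀ {b c bound} (Inv : ℕ → State → Set) →
    (∀ {k σ} → Inv (suc k) σ → InBoundsᵗ m σ b × test σ b ≡ true × Runs m c σ bound (Inv k)) →
    (∀ {σ} → Inv 0 σ → InBoundsᵗ m σ b × test σ b ≡ false) →
    ∀ k {σ} → Inv k σ → Runs m (while b c) σ (k * (costᵗ b + bound) + costᵗ b) (Inv 0)
  runs-while Inv body exit zero inv with b∈ , b≡ ← exit inv =
    _ , _ , ≤-refl , while-false b∈ b≡ , inv
  runs-while {b} {c} {bound} Inv body exit (suc k) inv
    with b∈ , b≡ , t , _ , t≤ , c⇓ , inv′ ← body inv
    with u , _ , u≤ , loop⇓ , end ← runs-while {b} {c} {bound} Inv body exit k inv′ =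
    _ , _ , time≤ , while-true b∈ b≡ c⇓ loop⇓ , end
    where
    time≤ : costᵗ b + (t + u) ≤ suc k * (costᵗ b + bound) + costᵗ b
    time≤ = begin
      costᵗ b + (t + u)                                             ≤⟨ +-monoʳ-≤ (costᵗ b) (+-mono-≤ t≤ u≤) ⟩
      costᵗ b + (bound + (k * (costᵗ b + bound) + costᵗ b))         ≡⟨ +-assoc (costᵗ b) bound _ ⟨
      costᵗ b + bound + (k * (costᵗ b + bound) + costᵗ b)           ≡⟨ +-assoc (costᵗ b + bound) _ (costᵗ b) ⟨
      suc k * (costᵗ b + bound) + costᵗ b                           ∎
      where open ≤-Reasoning

-- Reading an array after a store yields such a conditional; this separates the overwritten cell
-- from the others.
≡ᵇ-elim : ∀ (P : ℕ → Set) i j {v w} → (i ≡ j → P v) → (i ≢ j → P w) → P (if i ≡ᵇ j then v else w)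
≡ᵇ-elim P i j {v} {w} equal distinct with i ≟ j
... | yes eq rewrite ((i ≡ᵇ j) ≡ true)  ∋ dec-true  (i ≟ j) eq = equal eq
... | no neq rewrite ((i ≡ᵇ j) ≡ false) ∋ dec-false (i ≟ j) neq = distinct neq

applyUpTo-cong : ∀ {f g : ℕ → ℕ} n → (∀ i → i < n → f i ≡ g i) → applyUpTo f n ≡ applyUpTo g n
applyUpTo-cong zero    f≗g = refl
applyUpTo-cong (suc n) f≗g = cong₂ _∷_ (f≗g 0 z<s) (applyUpTo-cong n λ i i<n → f≗g (suc i) (s<s i<n))

cell-∈ : ∀ {es : List (ℕ × ℕ)} {i} → i < length es → (cell (map proj₁ es) i , cell (map proj₂ es) i) ∈ es
cell-∈ {_ ∷ _} {zero}  _   = here refl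
cell-∈ {_ ∷ _} {suc i} i<n = there (cell-∈ (s≤s⁻¹ i<n))

∈-cell : ∀ {es : List (ℕ × ℕ)} {a b} → (a , b) ∈ es →
  ∃[ i ] i < length es × cell (map proj₁ es) i ≡ a × cell (map proj₂ es) i ≡ b
∈-cell (here refl) = 0 , z<s , refl , refl
∈-cell (there e∈) with i , i<n , src , tgt ← ∈-cell e∈ = suc i , s<s i<n , src , tgt

-- As in the program's linked lists, 0 stands for the absence of an element.
Least : (ℕ → Set) → ℕ → Set
Least P h = (h ≡ 0 × (∀ {c} → ¬ P c)) ⊎ (P h × (∀ {c} → P c → h ≤ c))

least-resp : ∀ {P Q : ℕ → Set} {h} → (∀ {c} → P c → Q c) → (∀ {c} → Q c → P c) → Least P h → Least Q h
least-resp to from (inj₁ (h≡0 , none)) = inj₁ (h≡0 , none ∘ from)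
least-resp to from (inj₂ (Ph , least)) = inj₂ (to Ph , least ∘ from)

module Execution {n : ℕ} (π : Permutation′ n) (F : Graph) (F≅ : F ≅ encode π) where

  open Tree π
  open FlowGraph π F F≅

  -- The 2n + 1 edges are indexed up to 2n and the labels reach n + 1; 2n + 2 cells suffice for
  -- both, also when n = 0.
  m : ℕ
  m = 2 + (n + n)

  ≤root⇒<m : ∀ {v} → v ≤ suc n → v < m
  ≤root⇒<m v≤ = s≤s (≤-trans v≤ (s≤s (m≤m+n n n)))

  node<m : ∀ {c} → Node c → c < m
  node<m c∈ = ≤root⇒<m (m≤n⇒m≤1+n (node≤n c∈))

  parent<m : ∀ {c} → Node c → parent c < m
  parent<m c∈ with parent-inner c∈
  ... | inj₁ eq = subst (_< m) (sym eq) (≤root⇒<m ≤-refl)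
  ... | inj₂ v∈ = node<m v∈

  length-nodes : length (nodes F) ≡ 2 + n
  length-nodes = trans (↭-length (proj₁ F≅)) (length-downFrom (2 + n))

  length-edges : length (edges F) ≡ suc (n + n)
  length-edges = begin
    length (edges F)                      ≡⟨ ↭-length (proj₂ F≅) ⟩
    length (edges (encode π))             ≡⟨ length-++ forward ⟩
    length forward + length backward      ≡⟨ cong₂ _+_ (trans (length-map _ (upTo (suc n))) (length-upTo (suc n)))
                                                       (trans (length-map _ (allFin n)) (length-tabulate id)) ⟩
    suc (n + n)                           ∎
    where open ≡-Reasoning

  src tgt : ℕ → ℕ
  src = cell (map proj₁ (edges F))
  tgt = cell (map proj₂ (edges F))

  src<m : ∀ {i} → i < length (edges F) → src i < m
  src<m i<E with edge⁻ (cell-∈ i<E)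
  ... | inj₁ (eq , tgt≤n) = subst (_< m) (sym eq) (≤root⇒<m (s≤s tgt≤n))
  ... | inj₂ (c∈ , _)     = node<m c∈

  backward-tgt : ∀ {i} → i < length (edges F) → src i ≢ suc (tgt i) → tgt i ≡ parent (src i)
  backward-tgt i<E ≢forward with edge⁻ (cell-∈ i<E)
  ... | inj₁ (eq , _) = contradiction eq ≢forward
  ... | inj₂ (_ , eq) = eq

  -- Reading the parents from the edges

  record Rooted (σ : State) : Set where
    field
      root≡ : regs σ rootᵣ ≡ suc n
      last≡ : regs σ lastᵣ ≡ n

  record Building (k : ℕ) (σ : State) : Set where
    field
      rooted : Rooted σ
      size   : regs σ #E ≡ length (edges F)
      count  : regs σ kᵣ + k ≡ length (edges F)
      src≡   : ∀ i → arrays σ srcₐ i ≡ src i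
      tgt≡   : ∀ i → arrays σ tgtₐ i ≡ tgt i
      head≡0 : ∀ v → arrays σ headₐ v ≡ 0
      filled : ∀ i → i < regs σ kᵣ → src i ≢ suc (tgt i) → arrays σ parentₐ (src i) ≡ tgt i

  record Built (σ : State) : Set where
    field
      rooted  : Rooted σ
      parent≡ : ∀ {c} → Node c → arrays σ parentₐ c ≡ parent c

  building-exit : ∀ {σ} → Building 0 σ → InBoundsᵗ m σ (reg kᵣ ≺ reg #E) × test σ (reg kᵣ ≺ reg #E) ≡ false
  building-exit {σ} inv = _ , dec-false (regs σ kᵣ <? regs σ #E)
    (<-irrefl (trans (sym (+-identityʳ _)) (trans (Building.count inv) (sym (Building.size inv)))))

  building-step : ∀ {k σ} → Building (suc k) σ →
    InBoundsᵗ m σ (reg kᵣ ≺ reg #E) × test σ (reg kᵣ ≺ reg #E) ≡ true ×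
    Runs m (loopBody buildTree) σ 16 (Building k)
  building-step {k} {σ} inv = _ , dec-true (i <? regs σ #E) (subst (i <_) (sym size) i<E) , body
    where
    open Building inv
    i = regs σ kᵣ

    i<E : i < length (edges F)
    i<E = subst (i <_) count (m<m+n i z<s)

    i<m : i < m
    i<m = <-trans i<E (≤-reflexive (cong suc length-edges))

    count′ : i + 1 + k ≡ length (edges F)
    count′ = trans (+-assoc i 1 k) count

    earlier : ∀ {j} → j < i + 1 → j ≢ i → j < i
    earlier {j} j≤i = ≤∧≢⇒< (s≤s⁻¹ (subst (j <_) (+-comm i 1) j≤i))

    body : Runs m (loopBody buildTree) σ 16 (Building k)
    body with src i ≟ suc (tgt i)
    -- The test costs 7, the store 5 and `skip` 1; the cheaper branch is padded to 12.
    ... | yes forward = runs-then {s = 12} {t = 4} (runs-weaken (m≤m+n 8 4)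
            (runs-true ((_ , i<m) , (_ , i<m) , _)
              (dec-true (_ ≟ _) (trans (src≡ i) (trans forward (trans (cong suc (sym (tgt≡ i))) (+-comm 1 _)))))
              (runs-skip (runs-assign _ record
                -- Only `kᵣ` has changed. The other facts hold by computation in the new state, but
                -- their records are indexed by the state and are built anew.
                { rooted = record { Rooted rooted } ; size = size ; count = count′
                ; src≡ = src≡ ; tgt≡ = tgt≡ ; head≡0 = head≡0
                ; filled = λ j j≤i ≢forward →
                    filled j (earlier j≤i λ where refl → ≢forward forward) ≢forward }))))
    ... | no ≢forward = runs-then {s = 12} {t = 4} (runs-false ((_ , i<m) , (_ , i<m) , _)
            (dec-false (_ ≟ _) λ eq → ≢forward
              (trans (sym (src≡ i)) (trans eq (trans (+-comm _ 1) (cong suc (tgt≡ i))))))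
            (runs-store (_ , i<m) (_ , i<m) (subst (_< m) (sym (src≡ i)) (src<m i<E))
              (runs-assign _ record
                { rooted = record { Rooted rooted } ; size = size ; count = count′
                ; src≡ = src≡ ; tgt≡ = tgt≡ ; head≡0 = head≡0
                ; filled = λ j j≤i ≢forwardⱼ → ≡ᵇ-elim (_≡ tgt j) (src j) (arrays σ srcₐ i)
                    -- If the store hits the cell of an edge already read, both are backward edges
                    -- from one node, and both targets are its parent.
                    (λ eq → begin
                      arrays σ tgtₐ i        ≡⟨ tgt≡ i ⟩
                      tgt i                  ≡⟨ backward-tgt i<E ≢forward ⟩
                      parent (src i)         ≡⟨ cong parent (trans eq (src≡ i)) ⟨
                      parent (src j)         ≡⟨ backward-tgt (<-≤-trans (subst (j <_) (+-comm i 1) j≤i) i<E) ≢forwardⱼ ⟨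
                      tgt j                  ∎)
                    (λ neq → filled j (earlier j≤i λ where refl → neq (sym (src≡ i))) ≢forwardⱼ) })))
      where open ≡-Reasoning

  buildTree-runs : ∀ {σ} → Rooted σ → regs σ #E ≡ length (edges F) →
    (∀ i → arrays σ srcₐ i ≡ src i) → (∀ i → arrays σ tgtₐ i ≡ tgt i) → (∀ v → arrays σ headₐ v ≡ 0) →
    Runs m buildTree σ (2 + (length (edges F) * 19 + 3))
      (λ τ → Built τ × (∀ v → arrays τ headₐ v ≡ 0))
  buildTree-runs rooted size src≡ tgt≡ head≡0 =
    assign-then tt (finish (runs-while Building building-step building-exit (length (edges F)) record
      { rooted = record { Rooted rooted } ; size = size ; count = refl ; src≡ = src≡ ; tgt≡ = tgt≡ ; head≡0 = head≡0
      ; filled = λ _ () }))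
    where
    finish : ∀ {σ} →
      Runs m (while (reg kᵣ ≺ reg #E) (loopBody buildTree)) σ (length (edges F) * 19 + 3) (Building 0) →
      Runs m (while (reg kᵣ ≺ reg #E) (loopBody buildTree)) σ (length (edges F) * 19 + 3) (λ τ → Built τ × (∀ v → arrays τ headₐ v ≡ 0))
    finish (_ , τ , t≤ , ⇓ , inv) = _ , _ , t≤ , ⇓ , record { rooted = Building.rooted inv ; parent≡ = parent≡ } , Building.head≡0 inv
      where
      parent≡ : ∀ {c} → Node c → arrays τ parentₐ c ≡ parent c
      parent≡ c∈ with i , i<E , src-i , tgt-i ← ∈-cell (edge⁺ c∈) =
        trans (cong (arrays τ parentₐ) (sym src-i)) (trans
          (Building.filled inv i (subst (i <_) (sym (trans (sym (+-identityʳ _)) (Building.count inv))) i<E)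
            λ eq → backward≢forward c∈ (trans (sym src-i) (trans eq (cong suc tgt-i))))
          tgt-i)

  -- Building the lists of children

  NextSibling : ℕ → ℕ → Set
  NextSibling c = Least (λ d → Node d × c < d × parent d ≡ parent c)

  -- The nodes above k have been prepended. The linked lists are described by minimality of heads
  -- and successors alone, without forming them as lists.
  record Listing (k : ℕ) (σ : State) : Set where
    field
      built  : Built σ
      count  : regs σ kᵣ ≡ k
      k≤n    : k ≤ n
      heads  : ∀ v → Least (λ c → Node c × k < c × parent c ≡ v) (arrays σ headₐ v)
      nexts  : ∀ {c} → Node c → k < c → NextSibling c (arrays σ nextₐ c)

  listing-exit : ∀ {σ} → Listing 0 σ →
    InBoundsᵗ m σ (lit 0 ≺ reg kᵣ) × test σ (lit 0 ≺ reg kᵣ) ≡ false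
  listing-exit inv = _ , cong (0 <ᵇ_) (Listing.count inv)

  listing-step : ∀ {k σ} → Listing (suc k) σ →
    InBoundsᵗ m σ (lit 0 ≺ reg kᵣ) × test σ (lit 0 ≺ reg kᵣ) ≡ true ×
    Runs m (loopBody listChildren) σ 13 (Listing k)
  listing-step {k} {σ} inv = _ , cong (0 <ᵇ_) count ,
    store-then _ ((_ , K<m) , parent<m′) K<m
      (store-then (_ , K<m) _ parent<m′
        (runs-assign _ record
          { built = record { rooted = record { Rooted rooted } ; parent≡ = parent≡ }
          ; count = cong (_∸ 1) count ; k≤n = <⇒≤ k≤n ; heads = heads′ ; nexts = nexts′ }))
    where
    open Listing inv
    open Built built
    K = regs σ kᵣ

    k∈ : Node (suc k)
    k∈ = node⁺ z<s k≤n

    K<m : K < m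
    K<m = subst (_< m) (sym count) (node<m k∈)

    parent-K : arrays σ parentₐ K ≡ parent (suc k)
    parent-K = trans (cong (arrays σ parentₐ) count) (parent≡ k∈)

    parent<m′ : arrays σ parentₐ K < m
    parent<m′ = subst (_< m) (sym parent-K) (parent<m k∈)

    heads′ : ∀ v → Least (λ c → Node c × k < c × parent c ≡ v)
      (if v ≡ᵇ arrays σ parentₐ K then K else arrays σ headₐ v)
    heads′ v = ≡ᵇ-elim (Least _) v (arrays σ parentₐ K)
      (λ eq → subst (Least _) (sym count)
        (inj₂ ((k∈ , n<1+n k , sym (trans eq parent-K)) , λ (_ , k<c , _) → k<c)))
      (λ neq → least-resp (λ (c∈ , k<c , eq) → c∈ , <⇒≤ k<c , eq)
        (λ (c∈ , k<c , eq) → c∈ , ≤∧≢⇒< k<c (λ where refl → neq (trans (sym eq) (sym parent-K))) , eq)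
        (heads v))

    nexts′ : ∀ {c} → Node c → k < c →
      NextSibling c (if c ≡ᵇ K then arrays σ headₐ (arrays σ parentₐ K) else arrays σ nextₐ c)
    nexts′ {c} c∈ k<c = ≡ᵇ-elim (NextSibling c) c K
      -- The old head is the least child above k + 1 of the same parent, which is by definition the
      -- next sibling of k + 1.
      (λ eq → subst₂ (λ x y → NextSibling x (arrays σ headₐ y)) (sym (trans eq count)) (sym parent-K)
        (heads (parent (suc k))))
      (λ neq → nexts c∈ (≤∧≢⇒< k<c λ eq → neq (trans (sym eq) (sym count))))

  record Listed (σ : State) : Set where
    field
      built : Built σ
      nexts : ∀ {c} → Node c → NextSibling c (arrays σ nextₐ c)

  FirstUnvisited : ℕ → ℕ → ℕ → Set
  FirstUnvisited p v = Least (λ c → Node c × p < pos c × parent c ≡ v)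

  listChildren-runs : ∀ {σ} → Built σ → (∀ v → arrays σ headₐ v ≡ 0) →
    Runs m listChildren σ (2 + (n * 16 + 3)) (λ τ → Listed τ × (∀ v → FirstUnvisited 0 v (arrays τ headₐ v)))
  listChildren-runs {σ} built head≡0 =
    assign-then _ (finish (runs-while Listing listing-step listing-exit n record
      { built = record { rooted = record { Rooted rooted } ; parent≡ = parent≡ } ; count = last≡ ; k≤n = ≤-refl
      ; heads = λ v → inj₁ (head≡0 v , λ (c∈ , n<c , _) → <⇒≱ n<c (node≤n c∈))
      ; nexts = λ c∈ n<c → contradiction (node≤n c∈) (<⇒≱ n<c) }))
    where
    open Built built
    open Rooted rooted

    finish : ∀ {σ} →
      Runs m (while (lit 0 ≺ reg kᵣ) (loopBody listChildren)) σ (n * 16 + 3) (Listing 0) →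
      Runs m (while (lit 0 ≺ reg kᵣ) (loopBody listChildren)) σ (n * 16 + 3)
        (λ τ → Listed τ × (∀ v → FirstUnvisited 0 v (arrays τ headₐ v)))
    finish (_ , _ , t≤ , ⇓ , inv) = _ , _ , t≤ , ⇓ ,
      record { built = Listing.built inv ; nexts = λ c∈ → Listing.nexts inv c∈ (node>0 c∈) } ,
      -- Labels and positions of nodes are positive, so for k = 0 and p = 0 both descriptions range
      -- over all children.
      λ v → least-resp (λ (c∈ , _ , eq) → c∈ , node>0 (pos-node c∈) , eq)
                       (λ (c∈ , _ , eq) → c∈ , node>0 c∈ , eq) (Listing.heads inv v)

  -- The search loop

  Current : List ℕ → State → Set
  Current []      σ = regs σ activeᵣ ≡ 0
  Current (v ∷ _) σ = regs σ activeᵣ ≡ 1 × regs σ vᵣ ≡ v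

  -- `trace` fixes the number of rounds left. The path is not stored by the program; `chain` is what
  -- allows a retreat to read its next node from the parent array.
  record Searching (ℓ : ℕ) (σ : State) : Set where
    field
      {p}     : ℕ
      {path}  : List ℕ
      listed  : Listed σ
      time≡   : regs σ timeᵣ ≡ p
      heads   : ∀ v → FirstUnvisited p v (arrays σ headₐ v)
      times   : ∀ {c} → Node c → pos c ≤ p → arrays σ discₐ c ≡ pos c
      trace   : Walk ℓ p path
      chain   : Chain path
      current : Current path σ

  searching-exit : ∀ {σ} → Searching 0 σ →
    InBoundsᵗ m σ (lit 0 ≺ reg activeᵣ) × test σ (lit 0 ≺ reg activeᵣ) ≡ false
  searching-exit record { trace = done ; current = inactive } = _ , cong (0 <ᵇ_) inactive

  chain<m : ∀ {v vs} → Chain (v ∷ vs) → v < m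
  chain<m root           = ≤root⇒<m ≤-refl
  chain<m (child c∈ _ _) = node<m c∈

  searching-step : ∀ {ℓ σ} → Searching (suc ℓ) σ →
    InBoundsᵗ m σ (lit 0 ≺ reg activeᵣ) × test σ (lit 0 ≺ reg activeᵣ) ≡ true ×
    Runs m (loopBody search) σ 20 (Searching ℓ)
  searching-step {ℓ} {σ} record { p = p ; listed = listed ; time≡ = time≡ ; heads = heads ; times = times
    ; trace = discover {v = v} {vs} p<n parent-w trace ; chain = chain ; current = active , v≡ } =
    _ , cong (0 <ᵇ_) active ,
    runs-true (_ , _ , V<m) (dec-true (0 <? _) (subst (0 <_) (sym W≡w) (node>0 w∈)))
      (assign-then (_ , V<m)
      (store-then _ (_ , W<m) V<m
      (assign-then _
      (store-then _ _ W<m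
      (runs-assign _ record
        { listed = record { built = record { rooted = record { Rooted rooted } ; parent≡ = parent≡ } ; nexts = nexts }
        ; time≡ = time≡′ ; heads = heads′ ; times = times′
        ; trace = trace ; chain = child w∈ parent-w chain ; current = active , W≡w })))))
    where
    open Listed listed
    open Built built
    V = regs σ vᵣ
    W = arrays σ headₐ V
    w = lab (suc p)

    w∈ : Node w
    w∈ = lab-node (node⁺ z<s p<n)

    -- w is an unvisited child of the current node, so the head is at most w; a head at a later
    -- position would be a later sibling, hence greater.
    W≡w : W ≡ w
    W≡w with subst (λ x → FirstUnvisited p x W) v≡ (heads V)
    ... | inj₁ (_ , none) = contradiction (w∈ , subst (p <_) (sym (pos-lab p<n)) (n<1+n p) , parent-w) none
    ... | inj₂ ((h∈ , p<h , parent-h) , least) with m≤n⇒m<n∨m≡n p<h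
    ...   | inj₂ eq  = trans (sym (lab-pos h∈)) (cong lab (sym eq))
    ...   | inj₁ w⊏h = contradiction (least (w∈ , subst (p <_) (sym (pos-lab p<n)) (n<1+n p) , parent-w))
              (<⇒≱ (siblings w∈ h∈ (trans parent-w (sym parent-h)) (subst (_< pos W) (sym (pos-lab p<n)) w⊏h)))

    V<m : V < m
    V<m = subst (_< m) (sym v≡) (chain<m chain)

    W<m : W < m
    W<m = subst (_< m) (sym W≡w) (node<m w∈)

    time≡′ : regs σ timeᵣ + 1 ≡ suc p
    time≡′ = trans (+-comm _ 1) (cong suc time≡)

    -- For the current node, the siblings greater than w are those after position p + 1, so the
    -- successor of w is the new first unvisited child. Any other node does not have w as a child,
    -- and its unvisited children stay the same.
    heads′ : ∀ u → FirstUnvisited (suc p) u (if u ≡ᵇ V then arrays σ nextₐ W else arrays σ headₐ u)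
    heads′ u = ≡ᵇ-elim (FirstUnvisited (suc p) u) u V
      (λ eq → least-resp
        (λ (d∈ , w<d , sib) → d∈ , subst (_< _) (pos-lab p<n) (siblings⁻¹ w∈ d∈ (sym sib) w<d) ,
          trans sib (trans parent-w (sym (trans eq v≡))))
        (λ (d∈ , w⊏d , parent-d) → let sib = trans parent-d (trans eq (trans v≡ (sym parent-w))) in
          d∈ , siblings w∈ d∈ (sym sib) (subst (_< _) (sym (pos-lab p<n)) w⊏d) , sib)
        (subst (λ x → NextSibling w (arrays σ nextₐ x)) (sym W≡w) (nexts w∈)))
      (λ neq → least-resp
        (λ (d∈ , p<d , eq) → d∈ , ≤∧≢⇒< p<d (λ p≡d → neq (trans (sym eq) (trans
          (cong parent (trans (sym (lab-pos d∈)) (cong lab (sym p≡d)))) (trans parent-w (sym v≡))))) , eq)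
        (λ (d∈ , p<d , eq) → d∈ , <⇒≤ p<d , eq)
        (heads u))

    times′ : ∀ {c} → Node c → pos c ≤ suc p →
      (if c ≡ᵇ W then regs σ timeᵣ + 1 else arrays σ discₐ c) ≡ pos c
    times′ {c} c∈ c≤p = ≡ᵇ-elim (_≡ pos c) c W
      (λ eq → trans time≡′ (sym (trans (cong pos (trans eq W≡w)) (pos-lab p<n))))
      (λ neq → times c∈ (s≤s⁻¹ (≤∧≢⇒< c≤p λ eq →
        neq (trans (sym (lab-pos c∈)) (trans (cong lab eq) (sym W≡w))))))
  searching-step {ℓ} {σ} record { p = p ; listed = listed ; time≡ = time≡ ; heads = heads ; times = times
    ; trace = back {v = v} {vs} exhausted trace ; chain = chain ; current = active , v≡ } =
    _ , cong (0 <ᵇ_) active ,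
    -- A retreat costs at most 4 + 6; it is padded to the 20 of a discovery.
    runs-weaken (m≤m+n 10 10) (runs-false (_ , _ , V<m) (cong (0 <ᵇ_) head≡0) (retreat chain trace v≡))
    where
    open Listed listed
    open Built built
    open Rooted rooted
    V = regs σ vᵣ

    V<m : V < m
    V<m = subst (_< m) (sym v≡) (chain<m chain)

    head≡0 : arrays σ headₐ V ≡ 0
    head≡0 with subst (λ x → FirstUnvisited p x (arrays σ headₐ V)) v≡ (heads V)
    ... | inj₁ (h≡0 , _)                 = h≡0
    ... | inj₂ ((h∈ , p<h , parent-h) , _) = contradiction (exhausted h∈ parent-h) (<⇒≱ p<h)

    retreat : ∀ {v vs} → Chain (v ∷ vs) → Walk ℓ p vs → V ≡ v →
      Runs m (ifelse (reg vᵣ ≐ reg rootᵣ) (activeᵣ := lit 0) (vᵣ := arr parentₐ (reg vᵣ))) σ 6 (Searching ℓ)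
    retreat root trace v≡ = runs-weaken (m≤m+n 5 1) (runs-true _ (dec-true (V ≟ _) (trans v≡ (sym root≡)))
      (runs-assign _ record
        { listed = record { built = record { rooted = record { Rooted rooted } ; parent≡ = parent≡ } ; nexts = nexts }
        ; time≡ = time≡ ; heads = heads ; times = times ; trace = trace ; chain = empty ; current = refl }))
    retreat (child c∈ parent-c chain) trace v≡ = runs-false _
      (dec-false (V ≟ _) λ eq → <⇒≢ (s≤s (node≤n c∈)) (trans (sym v≡) (trans eq root≡)))
      (runs-assign (_ , V<m) record
        { listed = record { built = record { rooted = record { Rooted rooted } ; parent≡ = parent≡ } ; nexts = nexts }
        ; time≡ = time≡ ; heads = heads ; times = times ; trace = trace ; chain = chain
        ; current = active , trans (cong (arrays σ parentₐ) v≡) (trans (parent≡ c∈) parent-c) })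

  record Searched (σ : State) : Set where
    field
      rooted : Rooted σ
      times  : ∀ {c} → Node c → arrays σ discₐ c ≡ pos c

  search-runs : ∀ {σ} → Listed σ → (∀ v → FirstUnvisited 0 v (arrays σ headₐ v)) →
    Runs m search σ (9 + (suc (n + n) * 23 + 3)) Searched
  search-runs listed heads =
    assign-then _ (assign-then _ (store-then _ _ (subst (_< m) (sym root≡) (≤root⇒<m ≤-refl)) (assign-then _
      (finish (runs-while Searching searching-step searching-exit (suc (n + n)) record
        { listed = record { built = record { rooted = record { Rooted rooted } ; parent≡ = parent≡ } ; nexts = nexts }
        ; time≡ = refl ; heads = heads
        ; times = λ c∈ c≤0 → contradiction (node>0 (pos-node c∈)) (≤⇒≯ c≤0)
        ; trace = initialWalk ; chain = root ; current = refl , root≡ })))))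
    where
    open Listed listed
    open Built built
    open Rooted rooted

    finish : ∀ {σ} →
      Runs m (while (lit 0 ≺ reg activeᵣ) (loopBody search)) σ (suc (n + n) * 23 + 3) (Searching 0) →
      Runs m (while (lit 0 ≺ reg activeᵣ) (loopBody search)) σ (suc (n + n) * 23 + 3) Searched
    finish (_ , _ , t≤ , ⇓ , record { listed = listed ; trace = done ; times = times }) = _ , _ , t≤ , ⇓ , record
      { rooted = Built.rooted (Listed.built listed) ; times = λ c∈ → times c∈ (node≤n (pos-node c∈)) }

  -- Writing the elements by discovery time

  record Ordering (k : ℕ) (σ : State) : Set where
    field
      searched : Searched σ
      count    : regs σ kᵣ ≡ k
      k≤n      : k ≤ n
      written  : ∀ {c} → Node c → k < c → arrays σ outₐ (pos c) ≡ c

  ordering-exit : ∀ {σ} → Ordering 0 σ →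
    InBoundsᵗ m σ (lit 0 ≺ reg kᵣ) × test σ (lit 0 ≺ reg kᵣ) ≡ false
  ordering-exit inv = _ , cong (0 <ᵇ_) (Ordering.count inv)

  ordering-step : ∀ {k σ} → Ordering (suc k) σ →
    InBoundsᵗ m σ (lit 0 ≺ reg kᵣ) × test σ (lit 0 ≺ reg kᵣ) ≡ true ×
    Runs m (loopBody orderByTime) σ 8 (Ordering k)
  ordering-step {k} {σ} inv = _ , cong (0 <ᵇ_) count ,
    store-then (_ , K<m) _ (subst (_< m) (sym time-K) (node<m (pos-node k∈)))
      (runs-assign _ record
        { searched = record { rooted = record { Rooted rooted } ; times = times }
        ; count = cong (_∸ 1) count ; k≤n = <⇒≤ k≤n ; written = written′ })
    where
    open Ordering inv
    open Searched searched
    K = regs σ kᵣ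

    k∈ : Node (suc k)
    k∈ = node⁺ z<s k≤n

    K<m : K < m
    K<m = subst (_< m) (sym count) (node<m k∈)

    time-K : arrays σ discₐ K ≡ pos (suc k)
    time-K = trans (cong (arrays σ discₐ) count) (times k∈)

    written′ : ∀ {c} → Node c → k < c →
      (if pos c ≡ᵇ arrays σ discₐ K then K else arrays σ outₐ (pos c)) ≡ c
    written′ {c} c∈ k<c = ≡ᵇ-elim (_≡ c) (pos c) (arrays σ discₐ K)
      -- Nodes with equal positions coincide, so no earlier output is lost.
      (λ eq → trans count (trans (sym (lab-pos k∈)) (trans (cong lab (sym (trans eq time-K))) (lab-pos c∈))))
      (λ neq → written c∈ (≤∧≢⇒< k<c λ where refl → neq (sym time-K)))

  orderByTime-runs : ∀ {σ} → Searched σ → Runs m orderByTime σ (2 + (n * 11 + 3)) (Ordering 0)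
  orderByTime-runs searched =
    assign-then _ (runs-while Ordering ordering-step ordering-exit n record
      { searched = record { rooted = record { Rooted rooted } ; times = times } ; count = last≡ ; k≤n = ≤-refl
      ; written = λ c∈ n<c → contradiction (node≤n c∈) (<⇒≱ n<c) })
    where
    open Searched searched
    open Rooted rooted

  -- The leading 8 pays for the two assignments to `rootᵣ` and `lastᵣ`; the other summands are the
  -- bounds of the four phases in turn.
  timeBound : ℕ
  timeBound = 8 + (2 + (length (edges F) * 19 + 3) +
    ((2 + (n * 16 + 3)) + ((9 + (suc (n + n) * 23 + 3)) + (2 + (n * 11 + 3)))))

  decodeProgram-runs : Runs m decodeProgram (input F) timeBound (λ τ → output n τ ≡ sequence π)
  decodeProgram-runs =
    assign-then _ (assign-then _
      (runs-seq (buildTree-runs record { root≡ = cong (_∸ 1) length-nodes ; last≡ = cong (_∸ 2) length-nodes }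
        refl (λ _ → refl) (λ _ → refl) (λ _ → refl)) λ (built , head≡0) →
      runs-seq (listChildren-runs built head≡0) λ (listed , heads) →
      runs-seq (search-runs listed heads) λ searched →
      finish (orderByTime-runs searched)))
    where
    finish : ∀ {σ t} → Runs m orderByTime σ t (Ordering 0) → Runs m orderByTime σ t (λ τ → output n τ ≡ sequence π)
    finish (_ , τ , t≤ , ⇓ , inv) = _ , _ , t≤ , ⇓ , trans
      (applyUpTo-cong n λ i i<n → let w∈ = lab-node (node⁺ z<s i<n) in
        trans (cong (arrays τ outₐ) (sym (pos-lab i<n))) (Ordering.written inv w∈ (node>0 w∈)))
      (applyUpTo-cell-tabulate (λ p → label (π ⟨$⟩ʳ p)))

  timeBound≡ : timeBound ≡ 77 + 111 * n
  timeBound≡ rewrite length-edges = identity n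
    where
    identity : ∀ n → 8 + (2 + (suc (n + n) * 19 + 3) +
      ((2 + (n * 16 + 3)) + ((9 + (suc (n + n) * 23 + 3)) + (2 + (n * 11 + 3))))) ≡ 77 + 111 * n
    identity = solve-∀

  space≡ : 9 + 7 * m ≡ 23 + 14 * n
  space≡ = identity n
    where
    identity : ∀ n → 9 + 7 * (2 + (n + n)) ≡ 23 + 14 * n
    identity = solve-∀

affine-∈O : ∀ a b → (λ n → a + b * n) ∈O id
-- The threshold 1 provides a ≤ a * n.
affine-∈O a b = a + b , 1 , bound
  where
  bound : ∀ n → 1 ≤ n → a + b * n ≤ (a + b) * n
  bound n@(suc _) _ = ≤-trans (+-monoˡ-≤ (b * n) (m≤m*n a n)) (≤-reflexive (sym (*-distribʳ-+ n a b)))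

theorem3p4 : ∃[ time ] ∃[ space ]
    time ∈O (λ n → n) × space ∈O (λ n → n) ×
    (∀ (n : ℕ) (π : Permutation′ n) → SelfInverting π →
    ∀ (F : Graph) → F ≅ encode π →
    decode F ≡ sequence π ×
    (∃[ σ ] HaltsWithin (time n) (space n) decodeProgram (input F) σ ×
    output n σ ≡ decode F))
theorem3p4 = (λ n → 77 + 111 * n) , (λ n → 23 + 14 * n) , affine-∈O 77 111 , affine-∈O 23 14 , correct
  where
  correct : ∀ n (π : Permutation′ n) → SelfInverting π → ∀ F → F ≅ encode π →
    decode F ≡ sequence π ×
    (∃[ σ ] HaltsWithin (77 + 111 * n) (23 + 14 * n) decodeProgram (input F) σ × output n σ ≡ decode F)
  correct n π _ F F≅ =
    let t , σ , t≤ , ⇓ , out≡ = decodeProgram-runs in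
    decode≡sequence , σ ,
    (t , m , ≤-trans t≤ (≤-reflexive timeBound≡) , ≤-reflexive space≡ , ⇓) ,
    trans out≡ (sym decode≡sequence)
    where
    open FlowGraph π F F≅
    open Execution π F F≅
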